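{- In the extended lazy lambda calculus $L_{lcc}$: $\preccurlyeq_{lcc}\;=\;\preccurlyeq_{lcc,Q_{lcc}}\;=\;\le_{lcc,Q_{lcc}}$ (as relations on closed $\mathbb{E}_\lambda$-expressions), and $\preccurlyeq_{lcc}^{o}\;=\;\preccurlyeq_{lcc,Q_{lcc}}^{o}\;=\;\le_{lcc,Q_{lcc}}^{o}$.
   Context: **The calculus $L_{lcc}$.** Fix a set of data constructors partitioned into types; each constructor $c$ has an arity $\mathrm{ar}(c)\ge 0$; the constructors of type $T$ are enumerated as $c_{T,1},\dots,c_{T,|T|}$; there is a type Bool with nullary constructors True, False. Constructors occur only fully saturated. Expressions $\mathbb{E}_\lambda$ (up to $\alpha$-equivalence): $s,t::=x\mid(s\ t)\mid(\lambda x.s)\mid(c\ s_1\dots s_{\mathrm{ar}(c)})\mid(\mathtt{case}_T\ s\ \mathtt{of}\ alts)\mid(\mathtt{seq}\ s\ t)$, where $alts$ has exactly one alternative $((c\ y_1\dots y_{\mathrm{ar}(c)})\to r)$ for each constructor $c$ of type $T$ (the $y_i$ distinct variables bound in $r$). Answers (values): abstractions and constructor applications. Reduction contexts $R::=[\cdot]\mid(R\ s)\mid\mathtt{case}_T\ R\ \mathtt{of}\ alts\mid\mathtt{seq}\ R\ s$. Reduction $\xrightarrow{lcc}$: $R[((\lambda x.s)\ t)]\to R[s[t/x]]$; $R[\mathtt{case}_T\ (c\ s_1\dots s_k)\ \mathtt{of}\dots((c\ x_1\dots x_k)\to t)\dots]\to R[t[s_1/x_1,\dots,s_k/x_k]]$;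 $R[\mathtt{seq}\ v\ s]\to R[s]$ for a value $v$. $s\downarrow_{lcc}v$ means $s\xrightarrow{lcc,*}v$ for the answer $v$; $s\downarrow_{lcc}$ means such $v$ exists; otherwise $s$ diverges. $\Omega:=(\lambda z.(z\ z))\ (\lambda x.(x\ x))$. **Open extension.** For a relation $\eta$ on closed expressions: $s\,\eta^o\,t$ iff $\sigma(s)\,\eta\,\sigma(t)$ for all substitutions $\sigma$ with $\sigma(s),\sigma(t)$ closed. **Similarity $\preccurlyeq_{lcc}$.** $cBot$ is the set of $s\in\mathbb{E}_\lambda$ such that for all substitutions $\sigma$: if $\sigma(s)$ is closed, then $\sigma(s)$ diverges. $\preccurlyeq_{lcc}$ is the greatest fixpoint of the monotone operator $F_{lcc}$ on binary relations on closed expressions: $s\,F_{lcc}(\eta)\,t$ iff (1) if $s\downarrow_{lcc}\lambda x.s'$, then either $t\downarrow_{lcc}\lambda x.t'$ with $s'\,\eta^o\,t'$, or $t\downarrow_{lcc}(c\ t_1'\dots t_n')$ for some constructor $c$ and $s'\in cBot$; and (2) if $s\downarrow_{lcc}(c\ s_1'\dots s_n')$, then $t\downarrow_{lcc}(c\ t_1'\dots t_n')$ with $s_i'\,\eta\,t_i'$ for all $i$. **$Q_{lcc}$** consists of the contexts: (i) $([\cdot]\ r)$ for all closed $r\in\mathbb{E}_\lambda$; (ii) for all types $T$, constructors $c$ of $T$, and indices $i$: $(\mathtt{case}_T\ [\cdot]\ \mathtt{of}\dots((c\ x_1\dots x_{\mathrm{ar}(c)})\to x_i)\dots)$ with all other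 right-hand sides $\Omega$; (iii) for all $T$ and constructors $c$ of $T$: $(\mathtt{case}_T\ [\cdot]\ \mathtt{of}\dots((c\ x_1\dots x_{\mathrm{ar}(c)})\to\mathrm{True})\dots)$ with all other right-hand sides $\Omega$. $\preccurlyeq_{lcc,Q_{lcc}}$ is the greatest fixpoint of the operator $F$ on binary relations on closed expressions: $s\,F(\eta)\,t$ iff ($s\downarrow_{lcc}v$ implies there is $w$ with $t\downarrow_{lcc}w$ and $Q[v]\,\eta\,Q[w]$ for all $Q\in Q_{lcc}$). For closed $s,t$: $s\le_{lcc,Q_{lcc}}t$ iff for all $n\ge0$ and $Q_1,\dots,Q_n\in Q_{lcc}$: $Q_1[Q_2[\dots Q_n[s]]]\downarrow_{lcc}\Rightarrow Q_1[Q_2[\dots Q_n[t]]]\downarrow_{lcc}$. -}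

module Defs where

open import Data.Fin using (Fin; zero; suc; splitAt; _↑ˡ_; _↑ʳ_; _≟_)
open import Data.List using (List; foldr; allFin)
open import Data.List.Membership.Propositional.Properties using (∈-allFin)
open import Data.List.Relation.Unary.All as All using (All; []; _∷_)
open import Data.Nat using (ℕ; suc; _+_)
open import Data.Product using (Σ-syntax; ∃-syntax; _×_)
open import Data.Sum using (_⊎_; [_,_]′)
open import Data.Vec using (Vec; []; _∷_; lookup)
open import Function using (_∘_)
open import Level using (Level; 0ℓ) renaming (suc to lsuc)
open import Relation.Binary using (Rel; _⇒_)
open import Relation.Binary.Construct.Closure.ReflexiveTransitive using (Star)
open import Relation.Binary.PropositionalEquality using (_≡_; _≢_; refl; subst; sym)
open import Relation.Nullary using (¬_; yes; no)
open import Relation.Unary using (Pred; _∈_)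

-- Constructors are identified with pairs of a type T and a position in its
-- enumeration c_{T,1}, …, c_{T,|T|}, so distinct types share no constructor.
record Signature : Set₁ where
  field
    Type : Set
    ∣_∣  : Type → ℕ

  Con : Type → Set
  Con T = Fin ∣ T ∣

  field
    ar           : (T : Type) → Con T → ℕ
    Bool         : Type
    True False   : Con Bool
    True≢False   : True ≢ False
    Bool-only    : ∀ c → c ≡ True ⊎ c ≡ False
    Bool-nullary : ∀ c → ar Bool c ≡ 0

module Lcc (S : Signature) where
  open Signature S

  private variable
    n m : ℕ
    ℓ   : Level
    T   : Type

  -- Expressions modulo α-equivalence, as well-scoped de Bruijn terms with free
  -- variables in Fin n.  In the right-hand side of the alternative for c, the
  -- first ar T c indices are the pattern variables, in the order of the pattern.
  data Expr (n : ℕ) : Set where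
    var  : Fin n → Expr n
    app  : Expr n → Expr n → Expr n
    lam  : Expr (suc n) → Expr n
    con  : (T : Type) (c : Con T) → Vec (Expr n) (ar T c) → Expr n
    case : (T : Type) → Expr n →
           All (λ c → Expr (ar T c + n)) (allFin ∣ T ∣) → Expr n
    seq  : Expr n → Expr n → Expr n

  Closed : Set
  Closed = Expr 0

  Alts : Type → ℕ → Set
  Alts T n = All (λ c → Expr (ar T c + n)) (allFin ∣ T ∣)

  alt : Alts T n → (c : Con T) → Expr (ar T c + n)
  alt alts c = All.lookup alts (∈-allFin c)

  Sub : ℕ → ℕ → Set
  Sub n m = Fin n → Expr m

  liftRen : ∀ k → (Fin n → Fin m) → Fin (k + n) → Fin (k + m)
  liftRen {m = m} k ρ = [ _↑ˡ m , (k ↑ʳ_) ∘ ρ ]′ ∘ splitAt k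

  mutual
    rename : (Fin n → Fin m) → Expr n → Expr m
    rename ρ (var x)         = var (ρ x)
    rename ρ (app s t)       = app (rename ρ s) (rename ρ t)
    rename ρ (lam s)         = lam (rename (liftRen 1 ρ) s)
    rename ρ (con T c ss)    = con T c (renameArgs ρ ss)
    rename ρ (case T s alts) = case T (rename ρ s) (renameAlts T ρ alts)
    rename ρ (seq s t)       = seq (rename ρ s) (rename ρ t)

    renameArgs : ∀ {k} → (Fin n → Fin m) → Vec (Expr n) k → Vec (Expr m) k
    renameArgs ρ []       = []
    renameArgs ρ (s ∷ ss) = rename ρ s ∷ renameArgs ρ ss

    renameAlts : ∀ T {cs : List (Con T)} → (Fin n → Fin m) →
                 All (λ c → Expr (ar T c + n)) cs → All (λ c → Expr (ar T c + m)) cs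
    renameAlts T ρ []             = []
    renameAlts T ρ (_∷_ {c} r rs) = rename (liftRen (ar T c) ρ) r ∷ renameAlts T ρ rs

  liftSub : ∀ k → Sub n m → Sub (k + n) (k + m)
  liftSub {m = m} k σ = [ var ∘ (_↑ˡ m) , rename (k ↑ʳ_) ∘ σ ]′ ∘ splitAt k

  mutual
    _⟪_⟫ : Expr n → Sub n m → Expr m
    var x         ⟪ σ ⟫ = σ x
    app s t       ⟪ σ ⟫ = app (s ⟪ σ ⟫) (t ⟪ σ ⟫)
    lam s         ⟪ σ ⟫ = lam (s ⟪ liftSub 1 σ ⟫)
    con T c ss    ⟪ σ ⟫ = con T c (substArgs σ ss)
    case T s alts ⟪ σ ⟫ = case T (s ⟪ σ ⟫) (substAlts T σ alts)
    seq s t       ⟪ σ ⟫ = seq (s ⟪ σ ⟫) (t ⟪ σ ⟫)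

    substArgs : ∀ {k} → Sub n m → Vec (Expr n) k → Vec (Expr m) k
    substArgs σ []       = []
    substArgs σ (s ∷ ss) = s ⟪ σ ⟫ ∷ substArgs σ ss

    substAlts : ∀ T {cs : List (Con T)} → Sub n m →
                All (λ c → Expr (ar T c + n)) cs → All (λ c → Expr (ar T c + m)) cs
    substAlts T σ []             = []
    substAlts T σ (_∷_ {c} r rs) = r ⟪ liftSub (ar T c) σ ⟫ ∷ substAlts T σ rs

  -- r [ s₁/x₁ , … , s_k/x_k ] for the first k indices.
  _[_]ₛ : ∀ {k} → Expr (k + n) → Vec (Expr n) k → Expr n
  _[_]ₛ {k = k} r ss = r ⟪ [ lookup ss , var ]′ ∘ splitAt k ⟫

  data Value {n} : Pred (Expr n) 0ℓ where
    lam : ∀ s → Value (lam s)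
    con : ∀ T c ss → Value (con T c ss)

  -- A hole of a reduction context is never below a binder, so it has the same
  -- scope as the context.
  data RCtx (n : ℕ) : Set where
    [·]  : RCtx n
    app  : RCtx n → Expr n → RCtx n
    case : (T : Type) → RCtx n → Alts T n → RCtx n
    seq  : RCtx n → Expr n → RCtx n

  _[_] : RCtx n → Expr n → Expr n
  [·]           [ s ] = s
  app R t       [ s ] = app (R [ s ]) t
  case T R alts [ s ] = case T (R [ s ]) alts
  seq R t       [ s ] = seq (R [ s ]) t

  infix 4 _↦_ _⟶_ _⟶*_ _⇓_

  data _↦_ {n} : Rel (Expr n) 0ℓ where
    β      : ∀ s t → app (lam s) t ↦ s [ t ∷ [] ]ₛ
    case-β : ∀ T c ss alts → case T (con T c ss) alts ↦ alt alts c [ ss ]ₛ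
    seq-β  : ∀ {v} s → Value v → seq v s ↦ s

  data _⟶_ {n} : Rel (Expr n) 0ℓ where
    reduce : ∀ (R : RCtx n) {s t} → s ↦ t → R [ s ] ⟶ R [ t ]

  _⟶*_ : Rel (Expr n) 0ℓ
  _⟶*_ = Star _⟶_

  _⇓_ : Rel (Expr n) 0ℓ
  s ⇓ v = s ⟶* v × Value v

  Converges Diverges : Pred (Expr n) 0ℓ
  Converges s = ∃[ v ] s ⇓ v
  Diverges  s = ¬ Converges s

  Ω : Expr n
  Ω = app (lam (app (var zero) (var zero))) (lam (app (var zero) (var zero)))

  -- Closing substitutions of s, t : Expr n are exactly the maps into Closed.
  _ᵒ : Rel Closed ℓ → ∀ {n} → Rel (Expr n) ℓ
  (η ᵒ) {n} s t = ∀ (σ : Sub n 0) → η (s ⟪ σ ⟫) (t ⟪ σ ⟫)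

  cBot : Pred (Expr n) 0ℓ
  cBot {n} s = ∀ (σ : Sub n 0) → Diverges (s ⟪ σ ⟫)

  -- Knaster–Tarski: the union of all post-fixed points.  Quantifying over
  -- relations in Set puts the union in Set₁.
  gfp : (Rel Closed 0ℓ → Rel Closed 0ℓ) → Rel Closed (lsuc 0ℓ)
  gfp F s t = Σ[ η ∈ Rel Closed 0ℓ ] (η ⇒ F η) × η s t

  F-lcc : Rel Closed ℓ → Rel Closed ℓ
  F-lcc η s t =
      (∀ s′ → s ⇓ lam s′ →
          (∃[ t′ ] (t ⇓ lam t′ × (η ᵒ) s′ t′))
        ⊎ ((∃[ T ] ∃[ c ] ∃[ ts ] t ⇓ con T c ts) × s′ ∈ cBot))
    × (∀ T c ss → s ⇓ con T c ss →
          ∃[ ts ] (t ⇓ con T c ts × (∀ i → η (lookup ss i) (lookup ts i))))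

  infix 4 _≼lcc_ _≼lccQ_ _≤lccQ_

  _≼lcc_ : Rel Closed (lsuc 0ℓ)
  _≼lcc_ = gfp F-lcc

  trueE : Expr n
  trueE {n} = con Bool True (subst (Vec (Expr n)) (sym (Bool-nullary True)) [])

  onlyAt : (c : Con T) → Expr (ar T c + n) → (c′ : Con T) → Expr (ar T c′ + n)
  onlyAt c r c′ with c ≟ c′
  ... | yes refl = r
  ... | no _     = Ω

  only : (c : Con T) → Expr (ar T c + n) → Alts T n
  only c r = All.tabulate λ {c′} _ → onlyAt c r c′

  data Q-lcc : Pred (RCtx 0) 0ℓ where
    argument : ∀ r → Q-lcc (app [·] r)
    select   : ∀ T c (i : Fin (ar T c)) →
               Q-lcc (case T [·] (only c (var (i ↑ˡ 0))))
    test     : ∀ T c → Q-lcc (case T [·] (only c trueE))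

  F-Q : Rel Closed ℓ → Rel Closed ℓ
  F-Q η s t = ∀ v → s ⇓ v →
    ∃[ w ] (t ⇓ w × (∀ Q → Q ∈ Q-lcc → η (Q [ v ]) (Q [ w ])))

  _≼lccQ_ : Rel Closed (lsuc 0ℓ)
  _≼lccQ_ = gfp F-Q

  _≤lccQ_ : Rel Closed 0ℓ
  s ≤lccQ t = ∀ (Qs : List (RCtx 0)) → All Q-lcc Qs →
    Converges (foldr _[_] s Qs) → Converges (foldr _[_] t Qs)

{-# OPTIONS --safe #-}
-- The contexts in Q-lcc are evaluation contexts, so Q₁[…Qₙ[s]] converges only
-- if s has a value v, and replacing s by v preserves convergence because
-- reduction is deterministic.  Hence a simulation is contained in ≤lccQ, by
-- induction on the contexts from the innermost outwards: Q[v] and Q[w] are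
-- related, at least after some further reduction.  Conversely, ≤lccQ is itself
-- a post-fixed point of both operators: the contexts in Q-lcc apply
-- abstractions to all arguments, and test and take apart constructor
-- applications.  No congruence theorem for similarity is needed, as both sides
-- are always placed in the same Q.
module Submission where

open import Defs
open import Data.Empty using (⊥-elim)
open import Data.Fin using (Fin; zero; splitAt; _↑ˡ_; _≟_)
open import Data.Fin.Properties using (splitAt-↑ˡ)
open import Data.List using (List; []; _∷_; _∷ʳ_; foldr)
open import Data.List.Membership.Propositional using () renaming (_∈_ to _∈ₗ_)
open import Data.List.Membership.Propositional.Properties using (∈-allFin)
open import Data.List.Properties using (foldr-∷ʳ)
open import Data.List.Relation.Unary.All as All using (All; []; _∷_)
open import Data.List.Relation.Unary.All.Properties using (∷ʳ⁺; ∷ʳ⁻)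
open import Data.List.Relation.Unary.Any using (here; there)
open import Data.List.Reverse using (Reverse; reverseView; []; _∶_∶ʳ_)
open import Data.Nat using (ℕ; _+_)
open import Data.Product using (Σ-syntax; ∃-syntax; _×_; _,_; proj₁; proj₂)
open import Data.Sum using (_⊎_; inj₁; inj₂; [_,_]′)
open import Data.Sum.Properties using ([,]-cong)
open import Data.Vec using (Vec; []; _∷_; lookup)
open import Function using (_∘_; id)
open import Level using (0ℓ)
open import Relation.Binary using (Rel; _⇒_; _⇔_)
open import Relation.Binary.Construct.Closure.ReflexiveTransitive
  using (ε; _◅_; _◅◅_; gmap)
open import Relation.Binary.PropositionalEquality
  using (_≡_; _≢_; _≗_; refl; trans; cong; cong₂; subst)
open import Relation.Nullary using (¬_; yes; no)
open import Relation.Unary using (Pred; _∈_)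

lookup-tabulate : ∀ {a p} {A : Set a} {P : Pred A p} {xs : List A} {x : A}
                  (f : ∀ {x} → x ∈ₗ xs → P x) (x∈xs : x ∈ₗ xs) →
                  All.lookup (All.tabulate f) x∈xs ≡ f x∈xs
lookup-tabulate f (here refl)  = refl
lookup-tabulate f (there x∈xs) = lookup-tabulate (f ∘ there) x∈xs

-- `ar Bool True` is 0 only propositionally, so the argument vector of `trueE` is a transport of
-- `[]`; this shows that substitution leaves it unchanged.
nullary-unique : ∀ {a} {A : Set a} {k} → k ≡ 0 → (xs ys : Vec A k) → xs ≡ ys
nullary-unique refl [] [] = refl

module _ (S : Signature) where
  open Signature S
  open Lcc S

  private variable
    n m   : ℕ
    T T′  : Type
    s t u : Expr n

  -- Substitution and pointwise equality

  liftSub-cong : ∀ k {σ τ : Sub n m} → σ ≗ τ → liftSub k σ ≗ liftSub k τ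
  liftSub-cong k σ≗τ x = [,]-cong (λ _ → refl) (cong (rename _) ∘ σ≗τ) (splitAt k x)

  mutual
    -- Needed because contracting a β-redex yields a substitution that agrees with a given closing
    -- one only index by index.
    subst-cong : {σ τ : Sub n m} → σ ≗ τ → (s : Expr n) → s ⟪ σ ⟫ ≡ s ⟪ τ ⟫
    subst-cong σ≗τ (var x)         = σ≗τ x
    subst-cong σ≗τ (app s t)       = cong₂ app (subst-cong σ≗τ s) (subst-cong σ≗τ t)
    subst-cong σ≗τ (lam s)         = cong lam (subst-cong (liftSub-cong 1 σ≗τ) s)
    subst-cong σ≗τ (con T c ss)    = cong (con T c) (substArgs-cong σ≗τ ss)
    subst-cong σ≗τ (case T s alts) =
      cong₂ (case T) (subst-cong σ≗τ s) (substAlts-cong T σ≗τ alts)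
    subst-cong σ≗τ (seq s t)       = cong₂ seq (subst-cong σ≗τ s) (subst-cong σ≗τ t)

    substArgs-cong : ∀ {k} {σ τ : Sub n m} → σ ≗ τ → (ss : Vec (Expr n) k) →
                     substArgs σ ss ≡ substArgs τ ss
    substArgs-cong σ≗τ []       = refl
    substArgs-cong σ≗τ (s ∷ ss) = cong₂ _∷_ (subst-cong σ≗τ s) (substArgs-cong σ≗τ ss)

    substAlts-cong : ∀ T {cs} {σ τ : Sub n m} → σ ≗ τ →
                     (rs : All (λ c → Expr (ar T c + n)) cs) →
                     substAlts T σ rs ≡ substAlts T τ rs
    substAlts-cong T σ≗τ []             = refl
    substAlts-cong T σ≗τ (_∷_ {c} r rs) =
      cong₂ _∷_ (subst-cong (liftSub-cong (ar T c) σ≗τ) r) (substAlts-cong T σ≗τ rs)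

  -- Inversion and determinism of reduction

  -- Agda cannot match on a derivation of R [ s ] ⟶ R [ t ]; the congruence rules
  -- replacing the reduction context make inversion possible.
  infix 4 _⇾_

  data _⇾_ {n} : Rel (Expr n) 0ℓ where
    head : s ↦ t → s ⇾ t
    app  : ∀ {r} → s ⇾ t → app s r ⇾ app t r
    case : ∀ {alts} → s ⇾ t → case T s alts ⇾ case T t alts
    seq  : ∀ {r} → s ⇾ t → seq s r ⇾ seq t r

  fill-⇾ : (R : RCtx n) → s ↦ t → (R [ s ]) ⇾ (R [ t ])
  fill-⇾ [·]           s↦t = head s↦t
  fill-⇾ (app R r)     s↦t = app (fill-⇾ R s↦t)
  fill-⇾ (case T R as) s↦t = case (fill-⇾ R s↦t)
  fill-⇾ (seq R r)     s↦t = seq (fill-⇾ R s↦t)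

  ⟶⇒⇾ : s ⟶ t → s ⇾ t
  ⟶⇒⇾ (reduce R s↦t) = fill-⇾ R s↦t

  app-⟶ : ∀ {r} → s ⟶ t → app s r ⟶ app t r
  app-⟶ (reduce R s↦t) = reduce (app R _) s↦t

  case-⟶ : ∀ {as} → s ⟶ t → case T s as ⟶ case T t as
  case-⟶ (reduce R s↦t) = reduce (case _ R _) s↦t

  seq-⟶ : ∀ {r} → s ⟶ t → seq s r ⟶ seq t r
  seq-⟶ (reduce R s↦t) = reduce (seq R _) s↦t

  fill-⟶ : (R : RCtx n) → s ⟶ t → (R [ s ]) ⟶ (R [ t ])
  fill-⟶ [·]           p = p
  fill-⟶ (app R r)     p = app-⟶ (fill-⟶ R p)
  fill-⟶ (case T R as) p = case-⟶ (fill-⟶ R p)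
  fill-⟶ (seq R r)     p = seq-⟶ (fill-⟶ R p)

  ⇾⇒⟶ : s ⇾ t → s ⟶ t
  ⇾⇒⟶ (head s↦t) = reduce [·] s↦t
  ⇾⇒⟶ (app p)    = app-⟶ (⇾⇒⟶ p)
  ⇾⇒⟶ (case p)   = case-⟶ (⇾⇒⟶ p)
  ⇾⇒⟶ (seq p)    = seq-⟶ (⇾⇒⟶ p)

  ↦⇒⟶* : s ↦ t → s ⟶* t
  ↦⇒⟶* s↦t = reduce [·] s↦t ◅ ε

  value-irreducible : Value s → ¬ (s ⇾ t)
  value-irreducible (lam s)      (head ())
  value-irreducible (con T c ss) (head ())

  ⇾-deterministic : s ⇾ t → s ⇾ u → t ≡ u
  ⇾-deterministic (head (β _ _))          (head (β _ _))          = refl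
  ⇾-deterministic (head (case-β _ _ _ _)) (head (case-β _ _ _ _)) = refl
  ⇾-deterministic (head (seq-β _ _))      (head (seq-β _ _))      = refl
  ⇾-deterministic (app p)  (app q)  = cong (λ s → app s _) (⇾-deterministic p q)
  ⇾-deterministic (case p) (case q) = cong (λ s → case _ s _) (⇾-deterministic p q)
  ⇾-deterministic (seq p)  (seq q)  = cong (λ s → seq s _) (⇾-deterministic p q)
  ⇾-deterministic (head (β b _))  (app q)         = ⊥-elim (value-irreducible (lam b) q)
  ⇾-deterministic (app p)         (head (β b _))  = ⊥-elim (value-irreducible (lam b) p)
  ⇾-deterministic (head (seq-β _ v)) (seq q)      = ⊥-elim (value-irreducible v q)
  ⇾-deterministic (seq p)         (head (seq-β _ v)) = ⊥-elim (value-irreducible v p)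
  ⇾-deterministic (head (case-β T c ss _)) (case q) =
    ⊥-elim (value-irreducible (con T c ss) q)
  ⇾-deterministic (case p) (head (case-β T c ss _)) =
    ⊥-elim (value-irreducible (con T c ss) p)

  -- Convergence along reductions and inside contexts

  converges-⟶*-backward : s ⟶* t → Converges t → Converges s
  converges-⟶*-backward p (v , q , vv) = v , p ◅◅ q , vv

  -- By determinism the path to the value runs along `s ⟶* t`, and it cannot stop early since values
  -- do not reduce.
  converges-⟶*-forward : s ⟶* t → Converges s → Converges t
  converges-⟶*-forward ε       s⇓ = s⇓
  converges-⟶*-forward (p ◅ _) (_ , ε , vv) = ⊥-elim (value-irreducible vv (⟶⇒⇾ p))
  converges-⟶*-forward (p ◅ ps) (v , q ◅ qs , vv)
    with refl ← ⇾-deterministic (⟶⇒⇾ p) (⟶⇒⇾ q) = converges-⟶*-forward ps (v , qs , vv)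

  -- Every frame builds an `app`, `case` or `seq`, none of which is a value, so only the empty
  -- context remains.
  value-hole : (R : RCtx n) → Value (R [ s ]) → Value s
  value-hole [·] v = v

  app-⇾ : ∀ {r} → app s r ⇾ u → Value s ⊎ (∃[ s′ ] (s ⇾ s′ × u ≡ app s′ r))
  app-⇾ (head (β b _)) = inj₁ (lam b)
  app-⇾ (app p)        = inj₂ (_ , p , refl)

  case-⇾ : ∀ {as} → case T s as ⇾ u → Value s ⊎ (∃[ s′ ] (s ⇾ s′ × u ≡ case T s′ as))
  case-⇾ (head (case-β T c ss _)) = inj₁ (con T c ss)
  case-⇾ (case p)                 = inj₂ (_ , p , refl)

  seq-⇾ : ∀ {r} → seq s r ⇾ u → Value s ⊎ (∃[ s′ ] (s ⇾ s′ × u ≡ seq s′ r))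
  seq-⇾ (head (seq-β _ v)) = inj₁ v
  seq-⇾ (seq p)            = inj₂ (_ , p , refl)

  -- If a frame is itself contracted, its evaluated position holds a value, so the context below it
  -- is empty and that value is `s`. Otherwise the step descends into the frame.
  hole-⇾ : (R : RCtx n) → (R [ s ]) ⇾ u → Value s ⊎ (∃[ s′ ] (s ⇾ s′ × u ≡ R [ s′ ]))
  hole-⇾ [·] p = inj₂ (_ , p , refl)
  hole-⇾ (app R r) p with app-⇾ p
  ... | inj₁ v = inj₁ (value-hole R v)
  ... | inj₂ (_ , q , refl) with hole-⇾ R q
  ...   | inj₁ v                 = inj₁ v
  ...   | inj₂ (s′ , s⇾s′ , refl) = inj₂ (s′ , s⇾s′ , refl)
  hole-⇾ (case T R as) p with case-⇾ p
  ... | inj₁ v = inj₁ (value-hole R v)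
  ... | inj₂ (_ , q , refl) with hole-⇾ R q
  ...   | inj₁ v                 = inj₁ v
  ...   | inj₂ (s′ , s⇾s′ , refl) = inj₂ (s′ , s⇾s′ , refl)
  hole-⇾ (seq R r) p with seq-⇾ p
  ... | inj₁ v = inj₁ (value-hole R v)
  ... | inj₂ (_ , q , refl) with hole-⇾ R q
  ...   | inj₁ v                 = inj₁ v
  ...   | inj₂ (s′ , s⇾s′ , refl) = inj₂ (s′ , s⇾s′ , refl)

  converges-hole : (R : RCtx n) → Converges (R [ s ]) → Converges s
  converges-hole R (v , p , vv) = go p refl
    where
    -- Follows the path until the hole holds a value, at the latest at its end. `e` stays a variable
    -- so that the path can be matched on.
    go : ∀ {e s} → e ⟶* v → e ≡ R [ s ] → Converges s
    go ε       refl = _ , ε , value-hole R vv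
    go (p ◅ q) refl with hole-⇾ R (⟶⇒⇾ p)
    ... | inj₁ vs                = _ , ε , vs
    ... | inj₂ (s′ , s⇾s′ , eq) = converges-⟶*-backward (⇾⇒⟶ s⇾s′ ◅ ε) (go q eq)

  fill-⟶* : (R : RCtx n) → s ⟶* t → (R [ s ]) ⟶* (R [ t ])
  fill-⟶* R = gmap (R [_]) (fill-⟶ R)

  plug : List (RCtx n) → Expr n → Expr n
  plug Rs s = foldr _[_] s Rs

  plug-⟶* : (Rs : List (RCtx n)) → s ⟶* t → plug Rs s ⟶* plug Rs t
  plug-⟶* []       p = p
  plug-⟶* (R ∷ Rs) p = fill-⟶* R (plug-⟶* Rs p)

  converges-plug : (Rs : List (RCtx n)) → Converges (plug Rs s) → Converges s
  converges-plug []       s⇓ = s⇓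
  converges-plug (R ∷ Rs) s⇓ = converges-plug Rs (converges-hole R s⇓)

  -- Divergent expressions and the behaviour of the contexts in `Q-lcc`

  app-con-diverges : ∀ {c ss r} → Diverges {n} (app (con T c ss) r)
  app-con-diverges (_ , p ◅ _ , _) with ⟶⇒⇾ p
  ... | app (head ())

  case-lam-diverges : ∀ {b as} → Diverges {n} (case T (lam b) as)
  case-lam-diverges (_ , p ◅ _ , _) with ⟶⇒⇾ p
  ... | case (head ())

  Ω-diverges : Diverges {n} Ω
  Ω-diverges (_ , p , v) = go p v
    where
    go : ∀ {v} → Ω ⟶* v → ¬ Value v
    go ε ()
    -- The only reduct of `Ω` is `Ω` again, so the same claim recurs on a shorter path.
    go (p ◅ q) with refl ← ⇾-deterministic (head (β _ _)) (⟶⇒⇾ p) = go q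

  alt-only : (c : Con T) (r : Expr (ar T c + n)) (c′ : Con T) → alt (only c r) c′ ≡ onlyAt c r c′
  alt-only c r c′ = lookup-tabulate (λ {c′} _ → onlyAt c r c′) (∈-allFin c′)

  onlyAt-same : (c : Con T) (r : Expr (ar T c + n)) → onlyAt c r c ≡ r
  onlyAt-same c r with c ≟ c
  ... | yes refl = refl
  ... | no c≢c   = ⊥-elim (c≢c refl)

  onlyAt-other : {c c′ : Con T} (r : Expr (ar T c + n)) → c ≢ c′ → onlyAt c r c′ ≡ Ω
  onlyAt-other {c = c} {c′} r c≢c′ with c ≟ c′
  ... | yes c≡c′ = ⊥-elim (c≢c′ c≡c′)
  ... | no _     = refl

  case-only : ∀ {c : Con T} {ss} (r : Expr (ar T c + n)) →
              case T (con T c ss) (only c r) ⟶* r [ ss ]ₛ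
  case-only {T = T} {c = c} {ss} r =
    subst (λ r′ → case T (con T c ss) (only c r) ⟶* r′ [ ss ]ₛ)
      (trans (alt-only c r c) (onlyAt-same c r)) (↦⇒⟶* (case-β T c ss (only c r)))

  -- A different type leaves the `case` stuck; a different constructor of the same type selects `Ω`,
  -- which substitution does not change. Equating pairs lets one `refl` identify type and
  -- constructor together.
  case-only-matches : ∀ (c : Con T) (r : Expr (ar T c + n)) {c′ : Con T′} {ss} →
                      Converges (case T (con T′ c′ ss) (only c r)) →
                      _≡_ {A = Σ[ T ∈ Type ] Con T} (T , c) (T′ , c′)
  case-only-matches c r (_ , ε , ())
  case-only-matches c r (_ , p ◅ _ , _) with ⟶⇒⇾ p
  case-only-matches c r (_ , p ◅ _ , _) | case (head ())
  case-only-matches c r {c′} {ss} (v , p ◅ q , vv) | head (case-β _ _ _ _)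
    with c ≟ c′
  ... | yes refl = refl
  ... | no c≢c′ = ⊥-elim (Ω-diverges (subst (λ r′ → Converges (r′ [ ss ]ₛ))
                    (trans (alt-only c r c′) (onlyAt-other r c≢c′)) (v , q , vv)))

  trueE-subst : (σ : Sub n m) → trueE ⟪ σ ⟫ ≡ trueE
  trueE-subst σ = cong (con Bool True) (nullary-unique (Bool-nullary True) _ _)

  -- A closing substitution for one variable is determined by `σ zero`. This ties `_ᵒ` in `F-lcc` to
  -- the `argument` contexts.
  β-closed : ∀ (b : Expr 1) (σ : Sub 1 0) → app (lam b) (σ zero) ⟶* b ⟪ σ ⟫
  β-closed b σ = subst (app (lam b) (σ zero) ⟶*_) (subst-cong (λ { zero → refl }) b)
                   (↦⇒⟶* (β b (σ zero)))

  case-select : ∀ {c : Con T} (ss : Vec Closed (ar T c)) i →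
                case T (con T c ss) (only c (var (i ↑ˡ 0))) ⟶* lookup ss i
  case-select {T = T} {c} ss i =
    subst (case T (con T c ss) (only c (var (i ↑ˡ 0))) ⟶*_)
      (cong [ lookup ss , var ]′ (splitAt-↑ˡ (ar T c) i 0)) (case-only (var (i ↑ˡ 0)))

  case-test : ∀ {c : Con T} {ss : Vec Closed (ar T c)} →
              case T (con T c ss) (only c trueE) ⟶* trueE
  case-test {T = T} {c} {ss} =
    subst (case T (con T c ss) (only c trueE) ⟶*_) (trueE-subst _) (case-only trueE)

  -- Simulations are contained in `_≤lccQ_`

  -- Relatedness up to reduction on both sides.  Only convergent left-hand
  -- sides have to be matched, as equality of types need not be decidable.
  UpTo : Rel Closed 0ℓ → Rel Closed 0ℓ
  UpTo η s t = Converges s →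
    ∃[ s′ ] ∃[ t′ ] (s ⟶* s′ × t ⟶* t′ × (η s′ t′ ⊎ s′ ≡ t′))

  module _ {η : Rel Closed 0ℓ} (sim : ∀ {s t} → η s t → F-Q (UpTo η) s t) where

    -- The innermost context is the last entry, hence the reverse view: once the hole is evaluated,
    -- `Q` is absorbed into the next related pair and a shorter list remains.
    UpTo-simulation-plug : ∀ {Qs} → Reverse Qs → All Q-lcc Qs → ∀ {s t} → η s t →
                           Converges (plug Qs s) → Converges (plug Qs t)
    UpTo-simulation-plug [] [] sηt (v , s⇓v) with w , t⇓w , _ ← sim sηt v s⇓v = w , t⇓w
    UpTo-simulation-plug (Qs ∶ rs ∶ʳ Q) qs {s} {t} sηt s⇓
      rewrite foldr-∷ʳ _[_] s Q Qs | foldr-∷ʳ _[_] t Q Qs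
      with qs′ , q ← ∷ʳ⁻ qs
      with v , s⇓v ← converges-hole Q (converges-plug Qs s⇓)
      with w , t⇓w , match ← sim sηt v s⇓v
      -- `match` answers only when `Q [ v ]` converges, so convergence is first carried from `s` to
      -- `v`.
      with Qv⇓ ← converges-⟶*-forward (plug-⟶* Qs (fill-⟶* Q (proj₁ s⇓v))) s⇓
      with s′ , t′ , Qv⟶s′ , Qw⟶t′ , s′~t′ ← match Q q (converges-plug Qs Qv⇓)
      = converges-⟶*-backward
          (plug-⟶* Qs (fill-⟶* Q (proj₁ t⇓w) ◅◅ Qw⟶t′))
          (go s′~t′ (converges-⟶*-forward (plug-⟶* Qs Qv⟶s′) Qv⇓))
      where
      go : ∀ {s′ t′} → η s′ t′ ⊎ s′ ≡ t′ →
           Converges (plug Qs s′) → Converges (plug Qs t′)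
      go (inj₁ s′ηt′) = UpTo-simulation-plug rs (proj₁ (∷ʳ⁻ qs)) s′ηt′
      go (inj₂ refl)  = id

    UpTo-simulation⇒≤ : η ⇒ _≤lccQ_
    UpTo-simulation⇒≤ sηt Qs qs = UpTo-simulation-plug (reverseView Qs) qs sηt

  ≼lccQ⇒≤lccQ : _≼lccQ_ ⇒ _≤lccQ_
  ≼lccQ⇒≤lccQ (η , post , sηt) = UpTo-simulation⇒≤ upTo sηt
    where
    upTo : ∀ {s t} → η s t → F-Q (UpTo η) s t
    upTo sηt v s⇓v with w , t⇓w , related ← post sηt v s⇓v =
      w , t⇓w , λ Q q _ → _ , _ , ε , ε , inj₁ (related Q q)

  -- `F-lcc` relates bodies and components, whereas `F-Q` compares `Q [ v ]` with `Q [ w ]`; one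
  -- reduction on each side closes the gap.
  ≼lcc⇒≤lccQ : _≼lcc_ ⇒ _≤lccQ_
  ≼lcc⇒≤lccQ (η , post , sηt) = UpTo-simulation⇒≤ upTo sηt
    where
    upTo : ∀ {s t} → η s t → F-Q (UpTo η) s t
    upTo sηt _ (p , lam b) with proj₁ (post sηt) b (p , lam b)
    ... | inj₁ (b′ , t⇓ , b~b′) = lam b′ , t⇓ , λ where
      _ (argument r)   _  → _ , _ , ↦⇒⟶* (β b r) , ↦⇒⟶* (β b′ r) , inj₁ (b~b′ _)
      _ (select _ _ _) s⇓ → ⊥-elim (case-lam-diverges s⇓)
      _ (test _ _)     s⇓ → ⊥-elim (case-lam-diverges s⇓)
    -- Since the body is in `cBot`, the abstraction diverges on every argument, and no convergent
    -- left-hand side is left to match.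
    ... | inj₂ ((T , c , ts , t⇓) , bot) = con T c ts , t⇓ , λ where
      _ (argument r)   s⇓ → ⊥-elim (bot _ (converges-⟶*-forward (↦⇒⟶* (β b r)) s⇓))
      _ (select _ _ _) s⇓ → ⊥-elim (case-lam-diverges s⇓)
      _ (test _ _)     s⇓ → ⊥-elim (case-lam-diverges s⇓)
    upTo sηt _ (p , con T c ss) with ts , t⇓ , ss~ts ← proj₂ (post sηt) T c ss (p , con T c ss) =
      con T c ts , t⇓ , match
      where
      match : ∀ Q → Q ∈ Q-lcc → UpTo η (Q [ con T c ss ]) (Q [ con T c ts ])
      match _ (argument r)   s⇓ = ⊥-elim (app-con-diverges s⇓)
      match _ (select _ c′ i) s⇓ with refl ← case-only-matches c′ _ s⇓ =
        _ , _ , case-select ss i , case-select ts i , inj₁ (ss~ts i)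
      -- Both sides reach `trueE`, which `η` need not relate to itself; hence the equality
      -- alternative in `UpTo`.
      match _ (test _ c′)     s⇓ with refl ← case-only-matches c′ _ s⇓ =
        _ , _ , case-test , case-test , inj₂ refl

  -- `_≤lccQ_` as a post-fixed point of both operators

  ≤lccQ-⟶* : ∀ {s s′ t t′} → s ⟶* s′ → t ⟶* t′ → s ≤lccQ t → s′ ≤lccQ t′
  ≤lccQ-⟶* p q s≤t Qs qs s′⇓ =
    converges-⟶*-forward (plug-⟶* Qs q)
      (s≤t Qs qs (converges-⟶*-backward (plug-⟶* Qs p) s′⇓))

  -- A context placed around the hole is one more entry at the end of the list, over which the
  -- hypothesis already quantifies.
  ≤lccQ-fill : ∀ {s t Q} → Q ∈ Q-lcc → s ≤lccQ t → (Q [ s ]) ≤lccQ (Q [ t ])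
  ≤lccQ-fill {s} {t} {Q} q s≤t Qs qs Qs⇓
    with ih ← s≤t (Qs ∷ʳ Q) (∷ʳ⁺ qs q)
    rewrite foldr-∷ʳ _[_] s Q Qs | foldr-∷ʳ _[_] t Q Qs = ih Qs⇓

  ≤lccQ-converges : ∀ {s t} → s ≤lccQ t → Converges s → Converges t
  ≤lccQ-converges s≤t = s≤t [] []

  -- `_≤lccQ_` lives in `Rel Closed 0ℓ`, so it can itself be the witness that `gfp` asks for.
  ≤lccQ⇒≼lccQ : _≤lccQ_ ⇒ _≼lccQ_
  ≤lccQ⇒≼lccQ s≤t = _≤lccQ_ , post , s≤t
    where
    post : _≤lccQ_ ⇒ F-Q _≤lccQ_
    post s≤t v s⇓v with w , t⇓w ← ≤lccQ-converges s≤t (v , s⇓v) =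
      w , t⇓w , λ Q q → ≤lccQ-fill q (≤lccQ-⟶* (proj₁ s⇓v) (proj₁ t⇓w) s≤t)

  ≤lccQ-lam-lam : ∀ {b b′} → lam b ≤lccQ lam b′ → (_≤lccQ_ ᵒ) b b′
  ≤lccQ-lam-lam {b} {b′} b≤b′ σ =
    ≤lccQ-⟶* (β-closed b σ) (β-closed b′ σ) (≤lccQ-fill (argument (σ zero)) b≤b′)

  -- If the body converged under `σ`, then so would a constructor application in function position,
  -- applied to `σ zero`; but that is stuck.
  ≤lccQ-lam-con : ∀ {b c ts} → lam b ≤lccQ con T c ts → b ∈ cBot
  ≤lccQ-lam-con {b = b} b≤c σ b⇓ = app-con-diverges
    (≤lccQ-converges (≤lccQ-fill (argument (σ zero)) b≤c)
      (converges-⟶*-backward (β-closed b σ) b⇓))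

  -- `test` pins down the constructor, even a nullary one, for which there is no `select`; `select`
  -- then compares the components.
  ≤lccQ-con : ∀ {c ss w} → con T c ss ≤lccQ w → Value w →
              ∃[ ts ] (w ≡ con T c ts × (∀ i → lookup ss i ≤lccQ lookup ts i))
  ≤lccQ-con {T} {c} {ss} c≤w vw with
    ≤lccQ-converges (≤lccQ-fill (test T c) c≤w)
      (converges-⟶*-backward case-test (trueE , ε , con _ _ _))
  ≤lccQ-con c≤w (lam _) | w⇓ = ⊥-elim (case-lam-diverges w⇓)
  ≤lccQ-con {T} {c} {ss} c≤w (con _ _ ts) | w⇓ with refl ← case-only-matches c _ w⇓ =
    ts , refl , λ i →
      ≤lccQ-⟶* (case-select ss i) (case-select ts i) (≤lccQ-fill (select T c i) c≤w)

  ≤lccQ⇒≼lcc : _≤lccQ_ ⇒ _≼lcc_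
  ≤lccQ⇒≼lcc s≤t = _≤lccQ_ , post , s≤t
    where
    post : _≤lccQ_ ⇒ F-lcc _≤lccQ_
    proj₁ (post s≤t) b s⇓ with ≤lccQ-converges s≤t (lam b , s⇓)
    ... | _ , p , lam b′ =
      inj₁ (b′ , (p , lam b′) , ≤lccQ-lam-lam (≤lccQ-⟶* (proj₁ s⇓) p s≤t))
    ... | _ , p , con T c ts =
      inj₂ ((T , c , ts , p , con T c ts) , ≤lccQ-lam-con (≤lccQ-⟶* (proj₁ s⇓) p s≤t))
    proj₂ (post s≤t) T c ss s⇓
      with w , p , vw ← ≤lccQ-converges s≤t (con T c ss , s⇓)
      with ts , refl , ss≤ts ← ≤lccQ-con (≤lccQ-⟶* (proj₁ s⇓) p s≤t) vw =
      ts , (p , vw) , ss≤ts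

theorem4p37 : (S : Signature) → let open Lcc S in
    (_≼lcc_ ⇔ _≼lccQ_) × (_≼lccQ_ ⇔ _≤lccQ_)
    × (∀ (n : ℕ) → ((_≼lcc_ ᵒ) {n} ⇔ (_≼lccQ_ ᵒ) {n}) × ((_≼lccQ_ ᵒ) {n} ⇔ (_≤lccQ_ ᵒ) {n}))
theorem4p37 S =
    (sim⇒simQ , simQ⇒sim)
  , (≼lccQ⇒≤lccQ S , ≤lccQ⇒≼lccQ S)
  , λ n → ((λ s≼t σ → sim⇒simQ (s≼t σ)) , (λ s≼t σ → simQ⇒sim (s≼t σ)))
        , ((λ s≼t σ → ≼lccQ⇒≤lccQ S (s≼t σ)) , (λ s≤t σ → ≤lccQ⇒≼lccQ S (s≤t σ)))
  where
  open Lcc S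

  sim⇒simQ : _≼lcc_ ⇒ _≼lccQ_
  sim⇒simQ s≼t = ≤lccQ⇒≼lccQ S (≼lcc⇒≤lccQ S s≼t)

  simQ⇒sim : _≼lccQ_ ⇒ _≼lcc_
  simQ⇒sim s≼t = ≤lccQ⇒≼lcc S (≼lccQ⇒≤lccQ S s≼t)
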